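{- Let $m$ be a positive integer. In each of the following cases the displayed identity holds, and the triple consisting of $n_1=6m+5$ and the denominators $n_2,n_3$ of the second and third unit fractions on the right-hand side is a wild solution of the Erdős–Straus equation for $24m+1$. (1) If $m=19r-1+c(114r-1)$ with $r\in\mathbb N$, $r>0$, $c\in\mathbb N$, then $$\frac{4}{24m+1}=\frac{1}{6m+5}+\frac{1}{6r(6c+1)(24m+1)}+\frac{1}{6r(6c+1)(114r-1)(24m+1)}.$$ (2) If $m=95r+30+c(114r+37)$ with $r,c\in\mathbb N$, then $$\frac{4}{24m+1}=\frac{1}{6m+5}+\frac{1}{2(3r+1)(6c+5)(24m+1)}+\frac{1}{2(3r+1)(6c+5)(114r+37)(24m+1)}.$$
   Context: $\mathbb N$ denotes the set of nonnegative integers. For a positive integer $m$, the Erdős–Straus equation for $n=24m+1$ is $\frac{4}{n}=\frac1{n_1}+\frac1{n_2}+\frac1{n_3}$ in positive integers $n_1,n_2,n_3$. For $n_1=6m+k$ with $1\le k\le 12m$ one has $\frac{4}{24m+1}=\frac{1}{6m+k}+\frac{4k-1}{(6m+k)(24m+1)}$. A solution $(n_1,n_2,n_3)$ is called a wild solution if $n_1=6m+k$ for some integer $1\le k\le 12m$ and there exist an integer $L\ge 2$ (called a multiplier) and positive integers $J_1,J_2$ (called the numerator summands) such that $J_1+J_2=L(4k-1)$, $\gcd(L,J_1,J_2)=1$, $\frac1{n_2}=\frac{J_1}{L(6m+k)(24m+1)}$ and $\frac1{n_3}=\frac{J_2}{L(6m+k)(24m+1)}$. -}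

module Defs where

open import Data.Integer using (+_)
open import Data.Nat using (ℕ; suc; _+_; _*_; _∸_; _≤_; NonZero)
open import Data.Nat.GCD using (gcd)
open import Data.Nat.Properties using (m*n≢0; +-suc)
open import Data.Rational as ℚ using (ℚ)
open import Relation.Binary.PropositionalEquality using (_≡_; subst; sym)

infix  5 _÷_[_]
infixl 4.5 _⊕_

-- A fraction of naturals, with the proof that the denominator is nonzero
-- written after it; that proof is irrelevant.
_÷_[_] : ℕ → (d : ℕ) → .(NonZero d) → ℚ
a ÷ d [ d≢0 ] = (+ a ℚ./ d) {{d≢0}}

_⊕_ : ℚ → ℚ → ℚ
_⊕_ = ℚ._+_

m+suc≢0 : ∀ m n → NonZero (m + suc n)
m+suc≢0 m n = subst NonZero (sym (+-suc m n)) _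

24m+1≢0 : ∀ m → NonZero (24 * m + 1)
24m+1≢0 m = m+suc≢0 (24 * m) 0

6m+5≢0 : ∀ m → NonZero (6 * m + 5)
6m+5≢0 m = m+suc≢0 (6 * m) 4

private
  infixl 7 _·_

  _·_ : ∀ {m n} → NonZero m → NonZero n → NonZero (m * n)
  _·_ {m} {n} p q = m*n≢0 m n {{p}} {{q}}

  6r≢0 : ∀ r → .{{NonZero r}} → NonZero (6 * r)
  6r≢0 (suc _) = _

  114r∸1≢0 : ∀ r → .{{NonZero r}} → NonZero (114 * r ∸ 1)
  114r∸1≢0 (suc r) = m+suc≢0 r _

  6[m]+k≢0 : ∀ m {k} → 1 ≤ k → NonZero (6 * m + k)
  6[m]+k≢0 m {suc k} _ = m+suc≢0 (6 * m) k

  2≤⇒≢0 : ∀ {L} → 2 ≤ L → NonZero L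
  2≤⇒≢0 {suc _} _ = _

case₁-n₂≢0 : ∀ m r c → .{{NonZero r}} →
  NonZero (6 * r * (6 * c + 1) * (24 * m + 1))
case₁-n₂≢0 m r c = 6r≢0 r · m+suc≢0 (6 * c) 0 · 24m+1≢0 m

case₁-n₃≢0 : ∀ m r c → .{{NonZero r}} →
  NonZero (6 * r * (6 * c + 1) * (114 * r ∸ 1) * (24 * m + 1))
case₁-n₃≢0 m r c =
  6r≢0 r · m+suc≢0 (6 * c) 0 · 114r∸1≢0 r · 24m+1≢0 m

case₂-n₂≢0 : ∀ m r c →
  NonZero (2 * (3 * r + 1) * (6 * c + 5) * (24 * m + 1))
case₂-n₂≢0 m r c =
  _·_ {2} _ (m+suc≢0 (3 * r) 0) · 6m+5≢0 c · 24m+1≢0 m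

case₂-n₃≢0 : ∀ m r c →
  NonZero (2 * (3 * r + 1) * (6 * c + 5) * (114 * r + 37) * (24 * m + 1))
case₂-n₃≢0 m r c =
  _·_ {2} _ (m+suc≢0 (3 * r) 0) · 6m+5≢0 c · m+suc≢0 (114 * r) 36 · 24m+1≢0 m

wildDenominator≢0 : ∀ m {k L} → 1 ≤ k → 2 ≤ L →
  NonZero (L * (6 * m + k) * (24 * m + 1))
wildDenominator≢0 m 1≤k 2≤L = 2≤⇒≢0 2≤L · 6[m]+k≢0 m 1≤k · 24m+1≢0 m

record IsErdősStrausSolution (m n₁ n₂ n₃ : ℕ) : Set where
  field
    n₁≢0 : NonZero n₁
    n₂≢0 : NonZero n₂
    n₃≢0 : NonZero n₃
    equation : 4 ÷ 24 * m + 1 [ 24m+1≢0 m ]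
             ≡ 1 ÷ n₁ [ n₁≢0 ] ⊕ 1 ÷ n₂ [ n₂≢0 ] ⊕ 1 ÷ n₃ [ n₃≢0 ]

-- L is the multiplier and J₁, J₂ are the numerator summands.  Since 1 ≤ k,
-- the truncated subtraction in 4 * k ∸ 1 is the ordinary one.
record IsWildSolution (m n₁ n₂ n₃ : ℕ) : Set where
  field
    isSolution : IsErdősStrausSolution m n₁ n₂ n₃
  open IsErdősStrausSolution isSolution public
  field
    k L J₁ J₂ : ℕ
    1≤k       : 1 ≤ k
    k≤12m     : k ≤ 12 * m
    n₁≡6m+k   : n₁ ≡ 6 * m + k
    2≤L       : 2 ≤ L
    1≤J₁      : 1 ≤ J₁
    1≤J₂      : 1 ≤ J₂
    J₁+J₂     : J₁ + J₂ ≡ L * (4 * k ∸ 1)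
    gcd≡1     : gcd L (gcd J₁ J₂) ≡ 1
    1/n₂      : 1 ÷ n₂ [ n₂≢0 ]
              ≡ J₁ ÷ L * (6 * m + k) * (24 * m + 1) [ wildDenominator≢0 m 1≤k 2≤L ]
    1/n₃      : 1 ÷ n₃ [ n₃≢0 ]
              ≡ J₂ ÷ L * (6 * m + k) * (24 * m + 1) [ wildDenominator≢0 m 1≤k 2≤L ]

module Submission where

import Data.Integer as ℤ
import Data.Integer.Properties as ℤ
open import Data.Nat using (ℕ; suc; _+_; _*_; _∸_; _≤_; s≤s; z≤n; NonZero; >-nonZero; >-nonZero⁻¹)
open import Data.Nat.GCD using (gcd; gcd-zeroʳ)
open import Data.Nat.Properties
open import Data.Nat.Tactic.RingSolver using (solve-∀)
open import Data.Product using (_×_; _,_)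
import Data.Rational as ℚ
import Data.Rational.Properties as ℚ
import Data.Rational.Unnormalised as ℚᵘ
import Data.Rational.Unnormalised.Properties as ℚᵘ
open import Relation.Binary.PropositionalEquality using (_≡_; refl; sym; trans; cong; cong₂; module ≡-Reasoning)
open import Defs

-- With s = L (4k - 1) - 1 and 6m + k = q s, the fractions 1/(L q N) and
-- 1/(L q s N), N = 24m + 1, are s/D and 1/D for D = L (6m + k) N; they add up to
-- (4k - 1)/((6m + k) N).  So (6m + k, L q N, L q s N) is a wild solution with
-- multiplier L and numerator summands s and 1.  Both cases take k = 5: the first
-- has L = 6r and q = 6c + 1, the second L = 2 (3r + 1) and q = 6c + 5.

-- With successor denominators, `a ÷ suc d` unfolds to `fromℚᵘ` of an unnormalised fraction, for
-- which equality is cross-multiplication.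
÷-cong : ∀ a b d e .(d≢0 : NonZero d) .(e≢0 : NonZero e) →
  a * e ≡ b * d → a ÷ d [ d≢0 ] ≡ b ÷ e [ e≢0 ]
÷-cong a b (suc d) (suc e) _ _ eq =
  ℚ.fromℚᵘ-cong {ℚᵘ.mkℚᵘ (ℤ.+ a) d} {ℚᵘ.mkℚᵘ (ℤ.+ b) e} (ℚᵘ.*≡* (begin
  ℤ.+ a ℤ.* ℤ.+ suc e ≡⟨ ℤ.pos-* a (suc e) ⟨
  ℤ.+ (a * suc e)     ≡⟨ cong ℤ.+_ eq ⟩
  ℤ.+ (b * suc d)     ≡⟨ ℤ.pos-* b (suc d) ⟩
  ℤ.+ b ℤ.* ℤ.+ suc d ∎))
  where open ≡-Reasoning

-- Addition on `ℚ` normalises its result, so the sum is computed in `ℚᵘ`, where it has denominator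
-- `suc d * suc d`; `cross` removes the extra factor.
÷-⊕ : ∀ a b d .(d≢0 : NonZero d) →
  a ÷ d [ d≢0 ] ⊕ b ÷ d [ d≢0 ] ≡ (a + b) ÷ d [ d≢0 ]
÷-⊕ a b (suc d) _ = ℚ.toℚᵘ-injective (begin
  ℚ.toℚᵘ (x ⊕ y)                     ≈⟨ ℚ.toℚᵘ-homo-+ x y ⟩
  ℚ.toℚᵘ x ℚᵘ.+ ℚ.toℚᵘ y             ≈⟨ ℚᵘ.+-cong (ℚ.toℚᵘ-fromℚᵘ p) (ℚ.toℚᵘ-fromℚᵘ q) ⟩
  p ℚᵘ.+ q                           ≈⟨ ℚᵘ.*≡* cross ⟩
  ℚᵘ.mkℚᵘ (ℤ.+ (a + b)) d            ≈⟨ ℚ.toℚᵘ-fromℚᵘ (ℚᵘ.mkℚᵘ (ℤ.+ (a + b)) d) ⟨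
  ℚ.toℚᵘ ((a + b) ÷ suc d [ _ ])     ∎)
  where
  open ℚᵘ.≃-Reasoning
  x = a ÷ suc d [ _ ]
  y = b ÷ suc d [ _ ]
  p = ℚᵘ.mkℚᵘ (ℤ.+ a) d
  q = ℚᵘ.mkℚᵘ (ℤ.+ b) d
  cross : (ℤ.+ a ℤ.* ℤ.+ suc d ℤ.+ ℤ.+ b ℤ.* ℤ.+ suc d) ℤ.* ℤ.+ suc d
        ≡ ℤ.+ (a + b) ℤ.* (ℤ.+ suc d ℤ.* ℤ.+ suc d)
  -- Distributivity leaves `ℤ.+ a ℤ.+ ℤ.+ b`, which computes to `ℤ.+ (a + b)`.
  cross = trans (cong (ℤ._* ℤ.+ suc d) (sym (ℤ.*-distribʳ-+ (ℤ.+ suc d) (ℤ.+ a) (ℤ.+ b))))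
                (ℤ.*-assoc (ℤ.+ (a + b)) (ℤ.+ suc d) (ℤ.+ suc d))

wildSolution : ∀ m k L q s → 1 ≤ k → k ≤ 12 * m → 2 ≤ L →
  s + 1 ≡ L * (4 * k ∸ 1) → 6 * m + k ≡ q * s →
  IsWildSolution m (6 * m + k) (L * q * (24 * m + 1)) (L * q * s * (24 * m + 1))
wildSolution m k L q s 1≤k k≤12m 2≤L s+1≡Lt 6m+k≡qs = record
  { isSolution = record
    { n₁≢0     = n₁≢0
    ; n₂≢0     = n₂≢0
    ; n₃≢0     = n₃≢0
    ; equation = equation
    }
  ; k       = k
  ; L       = L
  ; J₁      = s
  ; J₂      = 1
  ; 1≤k     = 1≤k
  ; k≤12m   = k≤12m
  ; n₁≡6m+k = refl
  ; 2≤L     = 2≤L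
  ; 1≤J₁    = >-nonZero⁻¹ s
  ; 1≤J₂    = s≤s z≤n
  ; J₁+J₂   = s+1≡Lt
  -- The summand `J₂ = 1` makes the inner gcd 1, whatever `L` and `s` are.
  ; gcd≡1   = trans (cong (gcd L) (gcd-zeroʳ s)) (gcd-zeroʳ L)
  ; 1/n₂    = 1/n₂
  ; 1/n₃    = 1/n₃
  }
  where
  N t D : ℕ
  N = 24 * m + 1
  t = 4 * k ∸ 1
  D = L * (6 * m + k) * N

  n₁≢0 : NonZero (6 * m + k)
  n₁≢0 = >-nonZero (≤-trans 1≤k (m≤n+m k (6 * m)))

  instance
    -- Positivity passes from `k` to `6 * m + k`, hence to the product `q * s` and to both of its
    -- factors.
    qs≢0 : NonZero (q * s)
    qs≢0 = >-nonZero (≤-trans (>-nonZero⁻¹ _ {{n₁≢0}}) (≤-reflexive 6m+k≡qs))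
    q≢0 : NonZero q
    q≢0 = m*n≢0⇒m≢0 q
    s≢0 : NonZero s
    s≢0 = m*n≢0⇒n≢0 q
    L≢0 : NonZero L
    L≢0 = >-nonZero (≤-trans (s≤s z≤n) 2≤L)
    N≢0 : NonZero N
    N≢0 = 24m+1≢0 m
    Lq≢0 : NonZero (L * q)
    Lq≢0 = m*n≢0 L q
    Lqs≢0 : NonZero (L * q * s)
    Lqs≢0 = m*n≢0 (L * q) s

  n₂≢0 : NonZero (L * q * N)
  n₂≢0 = m*n≢0 (L * q) N

  n₃≢0 : NonZero (L * q * s * N)
  n₃≢0 = m*n≢0 (L * q * s) N

  D≢0 : NonZero D
  D≢0 = wildDenominator≢0 m 1≤k 2≤L

  1/n₁ : 1 ÷ 6 * m + k [ n₁≢0 ] ≡ L * N ÷ D [ D≢0 ]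
  1/n₁ = ÷-cong 1 (L * N) (6 * m + k) D n₁≢0 D≢0 (arith L (6 * m + k) N)
    where
    arith : ∀ L n N → 1 * (L * n * N) ≡ L * N * n
    arith = solve-∀

  1/n₂ : 1 ÷ L * q * N [ n₂≢0 ] ≡ s ÷ D [ D≢0 ]
  1/n₂ = ÷-cong 1 s (L * q * N) D n₂≢0 D≢0
    -- Replacing `6 * m + k` by `q * s` inside `D` exposes `D` as `s` times the denominator
    -- `L * q * N`.
    (trans (cong (λ n → 1 * (L * n * N)) 6m+k≡qs) (arith L q s N))
    where
    arith : ∀ L q s N → 1 * (L * (q * s) * N) ≡ s * (L * q * N)
    arith = solve-∀

  1/n₃ : 1 ÷ L * q * s * N [ n₃≢0 ] ≡ 1 ÷ D [ D≢0 ]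
  1/n₃ = ÷-cong 1 1 (L * q * s * N) D n₃≢0 D≢0
    (trans (cong (λ n → 1 * (L * n * N)) 6m+k≡qs) (arith L q s N))
    where
    arith : ∀ L q s N → 1 * (L * (q * s) * N) ≡ 1 * (L * q * s * N)
    arith = solve-∀

  -- This is `N + (4k - 1) = 4 (6m + k)` scaled by `L`, with `s + 1` standing for `L (4k - 1)`.
  numerators : L * N + s + 1 ≡ 4 * (L * (6 * m + k))
  numerators = begin
    L * N + s + 1            ≡⟨ +-assoc (L * N) s 1 ⟩
    L * N + (s + 1)          ≡⟨ cong (L * N +_) s+1≡Lt ⟩
    L * N + L * t            ≡⟨ arith₁ L m t ⟩
    -- Here `1 ≤ 4 * k` makes the truncated subtraction in `t` exact.
    L * (24 * m + (t + 1))   ≡⟨ cong (λ u → L * (24 * m + u)) (m∸n+n≡m 1≤4k) ⟩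
    L * (24 * m + 4 * k)     ≡⟨ arith₂ L m k ⟩
    4 * (L * (6 * m + k))    ∎
    where
    open ≡-Reasoning
    1≤4k : 1 ≤ 4 * k
    1≤4k = ≤-trans 1≤k (m≤n*m k 4)
    arith₁ : ∀ L m t → L * (24 * m + 1) + L * t ≡ L * (24 * m + (t + 1))
    arith₁ = solve-∀
    arith₂ : ∀ L m k → L * (24 * m + 4 * k) ≡ 4 * (L * (6 * m + k))
    arith₂ = solve-∀

  equation : 4 ÷ N [ 24m+1≢0 m ]
           ≡ 1 ÷ 6 * m + k [ n₁≢0 ] ⊕ 1 ÷ L * q * N [ n₂≢0 ] ⊕ 1 ÷ L * q * s * N [ n₃≢0 ]
  equation = sym (begin
    1 ÷ 6 * m + k [ n₁≢0 ] ⊕ 1 ÷ L * q * N [ n₂≢0 ] ⊕ 1 ÷ L * q * s * N [ n₃≢0 ]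
      ≡⟨ cong₂ _⊕_ (cong₂ _⊕_ 1/n₁ 1/n₂) 1/n₃ ⟩
    L * N ÷ D [ D≢0 ] ⊕ s ÷ D [ D≢0 ] ⊕ 1 ÷ D [ D≢0 ]
      ≡⟨ cong (_⊕ 1 ÷ D [ D≢0 ]) (÷-⊕ (L * N) s D D≢0) ⟩
    (L * N + s) ÷ D [ D≢0 ] ⊕ 1 ÷ D [ D≢0 ]
      ≡⟨ ÷-⊕ (L * N + s) 1 D D≢0 ⟩
    (L * N + s + 1) ÷ D [ D≢0 ]
      ≡⟨ ÷-cong (L * N + s + 1) 4 D N D≢0 (24m+1≢0 m)
           (trans (cong (_* N) numerators) (*-assoc 4 (L * (6 * m + k)) N)) ⟩
    4 ÷ N [ 24m+1≢0 m ] ∎)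
    where open ≡-Reasoning

theorem3p5 : (m : ℕ) → .{{_ : NonZero m}} →
    ((r c : ℕ) → .{{_ : NonZero r}} →
      m ≡ 19 * r ∸ 1 + c * (114 * r ∸ 1) →
      (4 ÷ 24 * m + 1 [ 24m+1≢0 m ]
        ≡ 1 ÷ 6 * m + 5 [ 6m+5≢0 m ]
        ⊕ 1 ÷ 6 * r * (6 * c + 1) * (24 * m + 1) [ case₁-n₂≢0 m r c ]
        ⊕ 1 ÷ 6 * r * (6 * c + 1) * (114 * r ∸ 1) * (24 * m + 1) [ case₁-n₃≢0 m r c ])
      × IsWildSolution m (6 * m + 5)
          (6 * r * (6 * c + 1) * (24 * m + 1))
          (6 * r * (6 * c + 1) * (114 * r ∸ 1) * (24 * m + 1)))
    ×
    ((r c : ℕ) →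
      m ≡ 95 * r + 30 + c * (114 * r + 37) →
      (4 ÷ 24 * m + 1 [ 24m+1≢0 m ]
        ≡ 1 ÷ 6 * m + 5 [ 6m+5≢0 m ]
        ⊕ 1 ÷ 2 * (3 * r + 1) * (6 * c + 5) * (24 * m + 1) [ case₂-n₂≢0 m r c ]
        ⊕ 1 ÷ 2 * (3 * r + 1) * (6 * c + 5) * (114 * r + 37) * (24 * m + 1) [ case₂-n₃≢0 m r c ])
      × IsWildSolution m (6 * m + 5)
          (2 * (3 * r + 1) * (6 * c + 5) * (24 * m + 1))
          (2 * (3 * r + 1) * (6 * c + 5) * (114 * r + 37) * (24 * m + 1)))
theorem3p5 m = case₁ , case₂
  where
  5≤12m : 5 ≤ 12 * m
  5≤12m = ≤-trans (m≤m+n 5 7) (m≤m*n 12 m)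

  -- The identity to be displayed is the `equation` field itself: nonzeroness proofs are irrelevant
  -- in `_÷_[_]`, so those of the record and those of the statement are interchangeable.
  withEquation : ∀ {n₁ n₂ n₃} (w : IsWildSolution m n₁ n₂ n₃) → let open IsWildSolution w in
    (4 ÷ 24 * m + 1 [ 24m+1≢0 m ]
      ≡ 1 ÷ n₁ [ n₁≢0 ] ⊕ 1 ÷ n₂ [ n₂≢0 ] ⊕ 1 ÷ n₃ [ n₃≢0 ])
    × IsWildSolution m n₁ n₂ n₃
  withEquation w = IsWildSolution.equation w , w

  case₁ : (r c : ℕ) → .{{_ : NonZero r}} → m ≡ 19 * r ∸ 1 + c * (114 * r ∸ 1) → _
  case₁ r c m≡ = withEquation
    (wildSolution m 5 (6 * r) (6 * c + 1) s (s≤s z≤n) 5≤12m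
      (≤-trans (m≤m+n 2 4) (m≤m*n 6 r)) s+1≡ 6m+5≡)
    where
    open ≡-Reasoning
    s = 114 * r ∸ 1
    a = 19 * r ∸ 1

    a+1≡ : a + 1 ≡ 19 * r
    a+1≡ = m∸n+n≡m (≤-trans (s≤s z≤n) (m≤m*n 19 r))

    s+1≡114r : s + 1 ≡ 114 * r
    s+1≡114r = m∸n+n≡m (≤-trans (s≤s z≤n) (m≤m*n 114 r))

    -- The factor 19 is `4 * k ∸ 1` at `k = 5`.
    s+1≡ : s + 1 ≡ 6 * r * 19
    s+1≡ = trans s+1≡114r (arith r)
      where
      arith : ∀ r → 114 * r ≡ 6 * r * 19
      arith = solve-∀

    6a+5≡s : 6 * a + 5 ≡ s
    -- Adding 1 to both sides turns the truncated `a` and `s` into the exact `19 * r` and `114 * r`.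
    6a+5≡s = +-cancelʳ-≡ 1 (6 * a + 5) s (begin
      6 * a + 5 + 1   ≡⟨ arith₁ a ⟩
      6 * (a + 1)     ≡⟨ cong (6 *_) a+1≡ ⟩
      6 * (19 * r)    ≡⟨ arith₂ r ⟩
      114 * r         ≡⟨ s+1≡114r ⟨
      s + 1           ∎)
      where
      arith₁ : ∀ a → 6 * a + 5 + 1 ≡ 6 * (a + 1)
      arith₁ = solve-∀
      arith₂ : ∀ r → 6 * (19 * r) ≡ 114 * r
      arith₂ = solve-∀

    -- At `c = 0` the value is `s`; each unit of `c` adds `s` to `m`, hence `6 * s` here.
    6m+5≡ : 6 * m + 5 ≡ (6 * c + 1) * s
    6m+5≡ = begin
      6 * m + 5              ≡⟨ cong (λ n → 6 * n + 5) m≡ ⟩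
      6 * (a + c * s) + 5    ≡⟨ arith₁ a c s ⟩
      6 * a + 5 + 6 * c * s  ≡⟨ cong (_+ 6 * c * s) 6a+5≡s ⟩
      s + 6 * c * s          ≡⟨ arith₂ c s ⟩
      (6 * c + 1) * s        ∎
      where
      arith₁ : ∀ a c s → 6 * (a + c * s) + 5 ≡ 6 * a + 5 + 6 * c * s
      arith₁ = solve-∀
      arith₂ : ∀ c s → s + 6 * c * s ≡ (6 * c + 1) * s
      arith₂ = solve-∀

  case₂ : (r c : ℕ) → m ≡ 95 * r + 30 + c * (114 * r + 37) → _
  case₂ r c m≡ = withEquation
    (wildSolution m 5 (2 * (3 * r + 1)) (6 * c + 5) (114 * r + 37) (s≤s z≤n) 5≤12m
      (*-monoʳ-≤ 2 (m≤n+m 1 (3 * r))) (s+1≡ r)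
      (trans (cong (λ n → 6 * n + 5) m≡) (6m+5≡ r c)))
    where
    s+1≡ : ∀ r → 114 * r + 37 + 1 ≡ 2 * (3 * r + 1) * 19
    s+1≡ = solve-∀
    -- With `s = 114 * r + 37`, the value at `c = 0` is `6 (95r + 30) + 5 = 5s`, and each unit of
    -- `c` adds `6s`; this is where the 5 in `q = 6 * c + 5` comes from.
    6m+5≡ : ∀ r c → 6 * (95 * r + 30 + c * (114 * r + 37)) + 5 ≡ (6 * c + 5) * (114 * r + 37)
    6m+5≡ = solve-∀
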